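{- Let $a\ge 3$ and $t\ge 2$ be fixed integers. Then there exist constants $c_1=c_1(a,t)>0$, $\lambda_1=\lambda_1(a,t)>1$, $c_2=c_2(a)>0$ and $\lambda_2=\lambda_2(a)<2$ (where $c_2$ and $\lambda_2$ depend only on $a$), and an integer $n_0(a,t)\ge a^t$, such that for all $n\ge n_0(a,t)$, $$p(a,t,n)\ge c_1\lambda_1^n \quad\text{and}\quad p(a,2,n)\le c_2\lambda_2^n.$$ In particular, $$p(a,t,n)\le p(a,2,n)\le\binom{n-1}{\lfloor n/a\rfloor-1}$$ for all $n\ge n_0(a,t)$.
   Context: Let $\Sigma_a=\{0,1,\ldots,a-1\}$ with $a\ge 2$, and let $t\ge 2$. For $\mathbf{v}\in\Sigma_a^n$ and $r\in[n]=\{1,\ldots,n\}$, $\mathbf{v}[r]$ denotes the $r$-th coordinate of $\mathbf{v}$. A set of vectors $\mathcal{V}=\{\mathbf{v}_1,\ldots,\mathbf{v}_k\}\subseteq \Sigma_a^n$ is called $t$-wise perfect with respect to $\Sigma_a$ if (i) $|\mathcal{V}|\ge t$, and (ii) for every $t$-tuple $(\mathbf{v}_{i_1},\ldots,\mathbf{v}_{i_t})$ with $1\le i_1<i_2<\cdots<i_t\le k$ and every string $\alpha\in\Sigma_a^t$, there is some $r\in[n]$ with $\mathbf{v}_{i_1}[r]\cdots\mathbf{v}_{i_t}[r]=\alpha$. For $n\ge a^t$ (for which such sets exist), $p(a,t,n)$ denotes the maximum size of a $t$-wise perfect set of vectors of length $n$ over $\Sigma_a$. -}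

module Defs where

import Algebra.Definitions.RawSemiring
open import Data.Bool.Base using (if_then_else_)
open import Data.Fin.Base using (Fin; _<_; funToFin; finToFun)
open import Data.Fin.Properties as Fin using (any?; injective⇒≤; finToFun-funToFin)
open import Data.Integer.Base using (+_)
open import Data.Nat.Base as ℕ using (ℕ; zero; suc; _≤_)
import Data.Nat.Properties as ℕ
open import Data.Product.Base using (∃; _×_; _,_)
open import Data.Rational.Base using (ℚ; _/_; +-*-rawSemiring)
open import Data.Vec.Base using (Vec; []; _∷_; lookup; map)
import Data.Vec.Properties as Vec
open import Data.Vec.Relation.Unary.AllPairs using (allPairs?)
open import Data.Vec.Relation.Unary.Linked using (Linked; linked?)
open import Data.Vec.Relation.Unary.Unique.Propositional using (Unique)
open import Data.Vec.Relation.Unary.Unique.Propositional.Properties using (lookup-injective)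
open import Relation.Binary.PropositionalEquality
  using (_≡_; sym; trans; cong; subst)
open import Relation.Nullary.Decidable
  using (Dec; yes; no; does; map′; ¬?; _→-dec_; _×-dec_; decidable-stable)
open import Relation.Unary using (Pred; Decidable)
open import Level using (0ℓ)

open Algebra.Definitions.RawSemiring +-*-rawSemiring public
  using () renaming (_^_ to _^ℚ_)

fromℕ : ℕ → ℚ
fromℕ m = (+ m) / 1

-- A set {v₁, …, vₖ} ⊆ Σₐⁿ of size k is given by a repetition-free
-- enumeration of its elements; Linked _<_ is ᵢ says i₁ < i₂ < ⋯ < iₜ.
record Perfect (a t n : ℕ) {k : ℕ} (V : Vec (Vec (Fin a) n) k) : Set where
  field
    distinct : Unique V
    large    : t ≤ k
    covers   : (is : Vec (Fin k) t) → Linked _<_ is → (α : Vec (Fin a) t) →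
               ∃ λ (r : Fin n) → map (λ i → lookup (lookup V i) r) is ≡ α

PerfectSize : (a t n k : ℕ) → Set
PerfectSize a t n k = ∃ λ (V : Vec (Vec (Fin a) n) k) → Perfect a t n V

private
  Searchable : Set → Set₁
  Searchable A = {P : Pred A 0ℓ} → Decidable P → Dec (∃ P)

  searchVec : ∀ {A} → Searchable A → ∀ m → Searchable (Vec A m)
  searchVec s zero    P? = map′ (λ p → [] , p) (λ { ([] , p) → p }) (P? [])
  searchVec s (suc m) P? =
    map′ (λ (x , xs , p) → x ∷ xs , p) (λ { (x ∷ xs , p) → x , xs , p })
         (s λ x → searchVec s m λ xs → P? (x ∷ xs))

  search∀ : ∀ {A} → Searchable A → {P : Pred A 0ℓ} → Decidable P → Dec (∀ x → P x)
  search∀ s P? =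
    map′ (λ ¬∃ x → decidable-stable (P? x) λ ¬p → ¬∃ (x , ¬p))
         (λ f (x , ¬p) → ¬p (f x))
         (¬? (s λ x → ¬? (P? x)))

perfect? : ∀ a t n {k} → Decidable (Perfect a t n {k})
perfect? a t n {k} V =
  map′ (λ (d , l , c) → record { distinct = d ; large = l ; covers = c })
       (λ p → let open Perfect p in distinct , large , covers)
       (allPairs? (λ x y → ¬? (Vec.≡-dec Fin._≟_ x y)) V
        ×-dec t ℕ.≤? k
        ×-dec search∀ (searchVec any? t) λ is →
                linked? Fin._<?_ is
                →-dec search∀ (searchVec any? t) λ α →
                        any? λ r → Vec.≡-dec Fin._≟_ _ α)

perfectSize? : ∀ a t n → Decidable (PerfectSize a t n)
perfectSize? a t n k = searchVec (searchVec any? n) k (perfect? a t n)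

-- The largest m ≤ b satisfying P, or 0 if there is none.
largest : {P : Pred ℕ 0ℓ} → Decidable P → ℕ → ℕ
largest P? zero    = zero
largest P? (suc b) = if does (P? (suc b)) then suc b else largest P? b

-- The search bound aⁿ is the number of vectors, so it excludes nothing
-- (see p-maximal).  If no perfect set exists, the value is 0.
p : (a t n : ℕ) → ℕ
p a t n = largest (perfectSize? a t n) (a ℕ.^ n)

private
  largest-upper : {P : Pred ℕ 0ℓ} (P? : Decidable P) → ∀ b {m} →
                  m ≤ b → P m → m ≤ largest P? b
  largest-upper P? zero    m≤b pm = m≤b
  largest-upper {P} P? (suc b) m≤b pm with P? (suc b)
  ... | yes _ = m≤b
  ... | no ¬p = largest-upper P? b
    (ℕ.≤-pred (ℕ.≤∧≢⇒< m≤b λ eq → ¬p (subst P eq pm))) pm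

  largest-holds : {P : Pred ℕ 0ℓ} (P? : Decidable P) → ∀ b {m} →
                  m ≤ b → P m → P (largest P? b)
  largest-holds {P} P? zero    m≤b pm = subst P (ℕ.n≤0⇒n≡0 m≤b) pm
  largest-holds {P} P? (suc b) m≤b pm with P? (suc b)
  ... | yes q = q
  ... | no ¬p = largest-holds P? b
    (ℕ.≤-pred (ℕ.≤∧≢⇒< m≤b λ eq → ¬p (subst P eq pm))) pm

  code-injective : ∀ {a n} {x y : Vec (Fin a) n} →
                   funToFin (lookup x) ≡ funToFin (lookup y) → x ≡ y
  code-injective {x = x} {y} eq =
    trans (sym (Vec.tabulate∘lookup x))
      (trans (Vec.tabulate-cong λ i →
               trans (sym (finToFun-funToFin (lookup x) i))
                 (trans (cong (λ c → finToFun c i) eq)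
                        (finToFun-funToFin (lookup y) i)))
             (Vec.tabulate∘lookup y))

  size≤aⁿ : ∀ {a t n k} → PerfectSize a t n k → k ≤ a ℕ.^ n
  size≤aⁿ (V , perf) = injective⇒≤ {f = λ i → funToFin (lookup (lookup V i))}
    λ eq → lookup-injective (Perfect.distinct perf) _ _ (code-injective eq)

p-maximal : ∀ {a t n k} → PerfectSize a t n k → k ≤ p a t n
p-maximal {a} {t} {n} s = largest-upper (perfectSize? a t n) (a ℕ.^ n) (size≤aⁿ s) s

p-attained : ∀ {a t n k} → PerfectSize a t n k → PerfectSize a t n (p a t n)
p-attained {a} {t} {n} s = largest-holds (perfectSize? a t n) (a ℕ.^ n) (size≤aⁿ s) s

{-# OPTIONS --safe #-}

module Submission where

open import Defs using (p; fromℕ; _^ℚ_)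
open import Data.Nat.Base using (ℕ; NonZero; _≤_; _^_; _∸_; _/_)
open import Data.Nat.Combinatorics using (_C_)
open import Data.Product.Base using (∃-syntax; _×_)
open import Data.Rational.Base as ℚ using (ℚ; 0ℚ; 1ℚ)

open import Algebra.Bundles using (CommutativeMonoid)
import Algebra.Properties.CommutativeSemigroup as CommutativeSemigroup
open import Data.Bool.Base using (true; false; if_then_else_)
open import Data.Fin.Base as Fin using (Fin; zero; suc; punchIn; combine; remQuot; funToFin; finToFun)
import Data.Fin.Properties as Fin
import Data.Integer.Base as ℤ
import Data.Integer.Properties as ℤ
open import Data.List.Base as List using (List; []; _∷_; length; filter)
open import Data.List.Membership.Propositional using () renaming (_∈_ to _∈ᴸ_)
import Data.List.Membership.Propositional.Properties as ∈ᴸ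
import Data.List.Properties as List
open import Data.List.Relation.Unary.All as All using (All; []; _∷_)
import Data.List.Relation.Unary.All.Properties as All
open import Data.List.Relation.Unary.AllPairs using (AllPairs; []; _∷_)
import Data.List.Relation.Unary.AllPairs.Properties as AllPairs
open import Data.Maybe.Base using (Maybe; just; nothing)
import Data.Maybe.Relation.Unary.All as Maybe
open import Data.Nat.Base using (zero; suc; _%_; _+_; _*_; _<_; _≥_; z≤n; s≤s; s≤s⁻¹;
  _≤′_; ≤′-refl; ≤′-step; >-nonZero; >-nonZero⁻¹)
open import Data.Nat.Combinatorics using (nCk+nC[k+1]≡[n+1]C[k+1])
open import Data.Nat.DivMod
open import Data.Nat.ListAction using () renaming (sum to sumᴸ)
open import Data.Nat.Properties
open import Data.Nat.Solver using (module +-*-Solver)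
open import Data.Product.Base using (∃; _,_; proj₁; proj₂)
open import Data.Rational.Base using (toℚᵘ)
import Data.Rational.Properties as ℚ
open import Data.Rational.Unnormalised.Base as ℚᵘ using (mkℚᵘ; *≡*; *<*; *≤*)
import Data.Rational.Unnormalised.Properties as ℚᵘ
open import Data.Sum.Base using (inj₁; inj₂; [_,_]′)
open import Data.Vec.Base as Vec using (Vec; []; _∷_; lookup; tabulate; map; zip; replicate; _[_]≔_)
open import Data.Vec.Functional using (Vector)
import Data.Vec.Membership.DecPropositional as Membership
open import Data.Vec.Membership.Propositional using () renaming (_∈_ to _∈ᵛ_; _∉_ to _∉ᵛ_)
import Data.Vec.Properties as Vec
open import Data.Vec.Relation.Binary.Pointwise.Inductive as Pointwise using (Pointwise; []; _∷_)
open import Data.Vec.Relation.Unary.All as Allᵛ using ([]; _∷_) renaming (All to Allᵛ)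
import Data.Vec.Relation.Unary.All.Properties as Allᵛ
open import Data.Vec.Relation.Unary.AllPairs using ([]; _∷_) renaming (AllPairs to AllPairsᵛ)
import Data.Vec.Relation.Unary.AllPairs.Properties as AllPairsᵛ
open import Data.Vec.Relation.Unary.Any as Any using (here; there)
import Data.Vec.Relation.Unary.Any.Properties as Any
open import Data.Vec.Relation.Unary.Linked using (Linked; []; [-]; _∷_)
import Data.Vec.Relation.Unary.Linked.Properties as Linked
open import Data.Vec.Relation.Unary.Unique.Propositional using (Unique)
open import Defs using (Perfect; PerfectSize; p-maximal; p-attained)
open import Function.Base using (_∘_; id; flip)
open import Level using (0ℓ)
open import Relation.Binary.Core using (Rel)
open import Relation.Binary.Definitions using (Decidable; Total; Transitive; tri<; tri≈; tri>)
open import Relation.Binary.PropositionalEquality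
open import Relation.Nullary.Decidable using (yes; no; does; ¬?; from-yes)
open import Relation.Nullary.Negation using (contradiction)

open import Algebra.Properties.Semiring.Sum +-*-semiring
  using (sum; sum-cong-≗; sum-syntax; ∑-distrib-+; sum-remove; sum-replicate-zero)
open CommutativeSemigroup *-commutativeSemigroup
  using () renaming (interchange to *-interchange)
open CommutativeSemigroup (CommutativeMonoid.commutativeSemigroup ℚ.*-1-commutativeMonoid)
  using () renaming (interchange to ℚ-interchange)

-- Both bounds count subcubes of Σₐⁿ, given by prescribing some of the
-- coordinates.
--
-- Upper bound.  In a word of length n over a symbols the two rarest
-- symbols x, y occupy at most 2n/a positions together.  Sending x to 0, y
-- to 1 and all else to "free" turns each vector of a pairwise perfect set
-- into a binary subcube of density at least 2^(-2n/a), and any two of these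
-- subcubes are disjoint: some coordinate shows x_i in v_i and y_j in v_j.
-- So there are at most 2^(2n/a) vectors.  For a ≥ 3 this beats both
-- (8/5)ⁿ, as 4 < (8/5)³, and the binomial coefficient, as
-- C(3k+2, k) ≥ 4 C(3k−1, k−1).
--
-- Lower bound.  A requirement "v_{i₁}[r] ⋯ v_{iₜ}[r] = α" is a subcube of
-- density a⁻ᵗ in the space of columns r.  Choosing each column to satisfy at
-- least an average share of the outstanding requirements leaves at most
-- (ka)ᵗ(1 − a⁻ᵗ)ⁿ of them, which is below 1 for k exponential in n.

-- Everything rests on two facts about densities of cubes. Pairwise disjoint cubes have total
-- density at most 1 (`kraft`). Conversely, `N` cubes of density at least `1/D` can all be hit by
-- `n` points once `N(1 - 1/D)^n < 1` (`hitting-set`), because some point lies in at least the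
-- fraction `1/D` of the cubes still outstanding.
--
-- For the upper bound, `covers-pair` reduces `t` to 2 by completing two rows to `t` rows.
-- `rare-pair` bounds the joint frequency of two symbols in each vector, and `rare-pairs-bound`
-- applies `kraft` to the resulting binary cubes. What remains is to compare `2^(2n/a)` with
-- `(8/5)^n` (`2^s*5^n≤8^n`) and with the binomial coefficient (`binomial-bound`).
--
-- For the lower bound, `covering-family` reads the `k` vectors as `n` columns of length `k` that
-- must hit all requirement cubes. By `few-requirements` this is possible for `k = 2^(q-a)`, where
-- `q` is the integer part of `n/((a^t-1)t)`; `exponential-bound` converts this size, which moves in
-- jumps, into a pure exponential in `n`.

private variable a k m n t : ℕ

-- Finite sums and extremal indices

∑-const : ∀ n x → ∑[ i < n ] x ≡ n * x
∑-const zero    x = refl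
∑-const (suc n) x = cong (x +_) (∑-const n x)

∑-mono-≤ : ∀ {n} {f g : Vector ℕ n} → (∀ i → f i ≤ g i) → sum f ≤ sum g
∑-mono-≤ {zero}  f≤g = z≤n
∑-mono-≤ {suc n} f≤g = +-mono-≤ (f≤g zero) (∑-mono-≤ (f≤g ∘ suc))

∑-indicator : ∀ {n} (x : Fin n) w → ∑[ s < n ] (if does (s Fin.≟ x) then w else 0) ≡ w
∑-indicator {suc n} zero    w = trans (cong (w +_) (sum-replicate-zero n)) (+-identityʳ w)
∑-indicator {suc n} (suc x) w = ∑-indicator x w

extremum : ∀ (_≲_ : Rel ℕ 0ℓ) → Total _≲_ → Transitive _≲_ →
           ∀ {n} (f : Vector ℕ (suc n)) → ∃[ i ] ∀ j → f i ≲ f j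
-- Totality at two equal arguments serves as reflexivity.
extremum _≲_ total trans′ {zero}  f = zero , λ { zero → [ id , id ]′ (total (f zero) (f zero)) }
extremum _≲_ total trans′ {suc n} f with extremum _≲_ total trans′ (f ∘ suc)
... | i , extreme with total (f zero) (f (suc i))
...   | inj₁ f₀≲fᵢ = zero , λ { zero → [ id , id ]′ (total (f zero) (f zero)) ; (suc j) → trans′ f₀≲fᵢ (extreme j) }
...   | inj₂ fᵢ≲f₀ = suc i , λ { zero → fᵢ≲f₀ ; (suc j) → extreme j }

-- Subcubes, their volumes and slices

Cube : ℕ → ℕ → Set
Cube a n = Vec (Maybe (Fin a)) n

infix 4 _∈_ _∈?_

_∈_ : Vec (Fin a) n → Cube a n → Set
_∈_ = Pointwise (λ s → Maybe.All (s ≡_))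

_∈?_ : Decidable (_∈_ {a} {n})
_∈?_ = Pointwise.decidable (λ s → Maybe.dec (s Fin.≟_))

volume : Cube a n → ℕ
volume         []            = 1
volume {a = a} (nothing ∷ c) = a * volume c
volume         (just _ ∷ c)  = volume c

total : List (Cube a n) → ℕ
total L = sumᴸ (List.map volume L)

restrict : Fin a → List (Cube a (suc n)) → List (Cube a n)
restrict s []                  = []
restrict s ((nothing ∷ c) ∷ L) = c ∷ restrict s L
restrict s ((just x ∷ c) ∷ L)  = if does (s Fin.≟ x) then c ∷ restrict s L else restrict s L

-- A free first coordinate puts the rest of the cube into all `a` slices, a prescribed one into
-- exactly one slice.
∑-restrict : (L : List (Cube a (suc n))) → ∑[ s < a ] total (restrict s L) ≡ total L
∑-restrict {a} []                  = sum-replicate-zero a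
∑-restrict {a} ((nothing ∷ c) ∷ L) =
  trans (∑-distrib-+ {a} _ _) (cong₂ _+_ (∑-const a (volume c)) (∑-restrict L))
∑-restrict {a} ((just x ∷ c) ∷ L)  = begin
  ∑[ s < a ] total (restrict s ((just x ∷ c) ∷ L))                             ≡⟨ sum-cong-≗ split ⟩
  ∑[ s < a ] ((if does (s Fin.≟ x) then volume c else 0) + total (restrict s L)) ≡⟨ ∑-distrib-+ {a} _ _ ⟩
  _
    ≡⟨ cong₂ _+_ (∑-indicator x (volume c)) (∑-restrict L) ⟩
  volume c + total L                                                             ∎
  where
  open ≡-Reasoning
  split : ∀ s → total (restrict s ((just x ∷ c) ∷ L)) ≡
                (if does (s Fin.≟ x) then volume c else 0) + total (restrict s L)
  split s with does (s Fin.≟ x)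
  ... | true  = refl
  ... | false = refl

-- Density at least `1/D`, with denominators cleared so that all counting stays in ℕ.
Dense : ℕ → Cube a n → Set
Dense {a} {n} D c = a ^ n ≤ D * volume c

total-dense : ∀ D {L : List (Cube a n)} → All (Dense D) L → length L * a ^ n ≤ D * total L
total-dense D []                                  = z≤n
total-dense D {c ∷ L} (c-dense ∷ L-dense) =
  ≤-trans (+-mono-≤ c-dense (total-dense D L-dense)) (≤-reflexive (sym (*-distribˡ-+ D (volume c) (total L))))

-- Disjoint cubes

Conflict : Cube a n → Cube a n → Set
Conflict c d = ∃[ r ] ∃[ x ] ∃[ y ] (lookup c r ≡ just x × lookup d r ≡ just y × x ≢ y)

-- Cubes surviving in the same slice cannot prescribe different first symbols, so their conflict
-- lies in a later coordinate.
restrict-conflicts : (s : Fin a) {L : List (Cube a (suc n))} →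
                     AllPairs Conflict L → AllPairs Conflict (restrict s L)
restrict-conflicts s [] = []
restrict-conflicts {a} {n} s (_∷_ {x ∷ c} {L} cs cL) = go x cs (restrict-conflicts s cL)
  where
  tail-conflict : ∀ {x y} {c d : Cube a n} → Maybe.All (s ≡_) x → Maybe.All (s ≡_) y →
                  Conflict (x ∷ c) (y ∷ d) → Conflict c d
  tail-conflict (Maybe.just refl) (Maybe.just refl) (zero , _ , _ , refl , refl , x≢y) = contradiction refl x≢y
  tail-conflict _ _ (suc r , conflict) = r , conflict

  tails : ∀ {x c} → Maybe.All (s ≡_) x → (L : List (Cube a (suc n))) →
          All (Conflict (x ∷ c)) L → All (Conflict c) (restrict s L)
  tails s∈x [] [] = []
  tails s∈x ((nothing ∷ d) ∷ L) (cd ∷ cL) = tail-conflict s∈x Maybe.nothing cd ∷ tails s∈x L cL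
  tails s∈x ((just y ∷ d) ∷ L) (cd ∷ cL) with s Fin.≟ y
  ... | yes s≡y = tail-conflict s∈x (Maybe.just s≡y) cd ∷ tails s∈x L cL
  ... | no  _   = tails s∈x L cL

  go : ∀ x → All (Conflict (x ∷ c)) L → AllPairs Conflict (restrict s L) →
       AllPairs Conflict (restrict s ((x ∷ c) ∷ L))
  go nothing  cs cL = tails Maybe.nothing L cs ∷ cL
  go (just y) cs cL with s Fin.≟ y
  ... | yes s≡y = tails (Maybe.just s≡y) L cs ∷ cL
  ... | no  _   = cL

-- Conflicting cubes share no point, so their volumes add up inside the whole space. The induction
-- cuts the space into `a` slices by the first coordinate.
kraft : ∀ n {L : List (Cube a n)} → AllPairs Conflict L → total L ≤ a ^ n
kraft     zero    []                         = z≤n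
kraft     zero    {[] ∷ []}    _             = ≤-refl
-- In dimension 0 there is no coordinate in which two cubes could conflict.
kraft     zero    (((() , _) ∷ _) ∷ _)
kraft {a} (suc n) {L} conflicts              = begin
  total L                            ≡⟨ ∑-restrict L ⟨
  ∑[ s < a ] total (restrict s L)    ≤⟨ ∑-mono-≤ (λ s → kraft n (restrict-conflicts s conflicts)) ⟩
  ∑[ s < a ] (a ^ n)                  ≡⟨ ∑-const a (a ^ n) ⟩
  a * a ^ n                          ∎
  where open ≤-Reasoning

-- Hitting all cubes with few points

hits misses : Vec (Fin a) n → List (Cube a n) → List (Cube a n)
hits   x = filter (x ∈?_)
misses x = filter (¬? ∘ (x ∈?_))

hits+misses : (x : Vec (Fin a) n) (L : List (Cube a n)) →
              length (hits x L) + length (misses x L) ≡ length L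
hits+misses x []      = refl
hits+misses x (c ∷ L) with does (x ∈? c)
... | true  = cong suc (hits+misses x L)
... | false = trans (+-suc _ _) (cong suc (hits+misses x L))

hits-restrict : ∀ s (x : Vec (Fin a) n) (L : List (Cube a (suc n))) →
                length (hits (s ∷ x) L) ≡ length (hits x (restrict s L))
hits-restrict s x []                  = refl
hits-restrict s x ((nothing ∷ c) ∷ L) with does (x ∈? c)
... | true  = cong suc (hits-restrict s x L)
... | false = hits-restrict s x L
hits-restrict s x ((just y ∷ c) ∷ L) with does (s Fin.≟ y)
... | false = hits-restrict s x L
... | true  with does (x ∈? c)
...   | true  = cong suc (hits-restrict s x L)
...   | false = hits-restrict s x L

-- Some point lies in at least as many cubes as an average point; its
-- symbols are chosen one at a time, each to maximise the conditional mean.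
popular-point : ∀ n (L : List (Cube (suc a) n)) →
                ∃[ x ] total L ≤ suc a ^ n * length (hits x L)
popular-point zero L = [] , ≤-reflexive (count-points L)
  where
  count-points : (L : List (Cube (suc a) 0)) → total L ≡ 1 * length (hits [] L)
  count-points []       = refl
  count-points ([] ∷ L) = cong suc (count-points L)
popular-point {a} (suc n) L
  using s , max ← extremum _≥_ (flip ≤-total) (flip ≤-trans) (λ s → total (restrict s L))
  with x , popular ← popular-point n (restrict s L) = s ∷ x , (begin
  total L                                              ≡⟨ ∑-restrict L ⟨
  ∑[ s < suc a ] total (restrict s L)                  ≤⟨ ∑-mono-≤ max ⟩
  ∑[ _ < suc a ] total (restrict s L)                  ≡⟨ ∑-const (suc a) _ ⟩
  suc a * total (restrict s L)                         ≤⟨ *-monoʳ-≤ (suc a) popular ⟩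
  suc a * (suc a ^ n * length (hits x (restrict s L))) ≡⟨ *-assoc (suc a) (suc a ^ n) _ ⟨
  suc a ^ suc n * length (hits x (restrict s L))       ≡⟨ cong (suc a ^ suc n *_) (hits-restrict s x L) ⟨
  suc a ^ suc n * length (hits (s ∷ x) L)              ∎)
  where open ≤-Reasoning

few-misses : ∀ E {L : List (Cube (suc a) n)} → All (Dense (suc E)) L →
             ∃[ x ] suc E * length (misses x L) ≤ E * length L
-- The right-hand side `suc E * length L` unfolds to `length L + E * length L`, hence the
-- cancellation of `length L`.
few-misses {a} {n} E {L} dense with x , popular ← popular-point n L = x , +-cancelˡ-≤ (length L) _ _ (begin
  length L + suc E * length (misses x L)                    ≤⟨ +-monoˡ-≤ _ L≤D*hits ⟩
  suc E * length (hits x L) + suc E * length (misses x L)   ≡⟨ *-distribˡ-+ (suc E) (length (hits x L)) _ ⟨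
  suc E * (length (hits x L) + length (misses x L))         ≡⟨ cong (suc E *_) (hits+misses x L) ⟩
  suc E * length L                                          ∎)
  where
  open ≤-Reasoning
  instance _ = m^n≢0 (suc a) n
  L≤D*hits : length L ≤ suc E * length (hits x L)
  L≤D*hits = *-cancelʳ-≤ _ _ (suc a ^ n) (begin
    length L * suc a ^ n                     ≤⟨ total-dense (suc E) dense ⟩
    suc E * total L                          ≤⟨ *-monoʳ-≤ (suc E) popular ⟩
    suc E * (suc a ^ n * length (hits x L))  ≡⟨ cong (suc E *_) (*-comm (suc a ^ n) _) ⟩
    suc E * (length (hits x L) * suc a ^ n)  ≡⟨ *-assoc (suc E) (length (hits x L)) _ ⟨
    suc E * length (hits x L) * suc a ^ n    ∎)

-- Greedy choice: each point leaves at most the fraction `E/(E+1)` of the cubes unhit. The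
-- hypothesis says that after `m` points fewer than one cube, hence none, is left.
hitting-set : ∀ E m {L : List (Cube (suc a) n)} → All (Dense (suc E)) L →
              length L * E ^ m < suc E ^ m →
              ∃ λ (xs : Vec (Vec (Fin (suc a)) n) m) → All (λ c → ∃[ r ] lookup xs r ∈ c) L
hitting-set E zero    {[]}    dense few = [] , []
hitting-set E zero    {_ ∷ _} dense (s≤s ())
hitting-set E (suc m) {L} dense few = x ∷ xs , All.tabulate found
  where
  open ≤-Reasoning
  x-rare = few-misses E dense
  x = proj₁ x-rare

  fewer : length (misses x L) * E ^ m < suc E ^ m
  fewer = *-cancelˡ-< (suc E) _ _ (begin-strict
    suc E * (length (misses x L) * E ^ m)  ≡⟨ *-assoc (suc E) (length (misses x L)) _ ⟨
    suc E * length (misses x L) * E ^ m    ≤⟨ *-monoˡ-≤ (E ^ m) (proj₂ x-rare) ⟩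
    E * length L * E ^ m                   ≡⟨ cong (_* E ^ m) (*-comm E (length L)) ⟩
    length L * E * E ^ m                   ≡⟨ *-assoc (length L) E _ ⟩
    length L * E ^ suc m                   <⟨ few ⟩
    suc E ^ suc m                          ∎)

  rest = hitting-set E m (All.filter⁺ (¬? ∘ (x ∈?_)) dense) fewer
  xs = proj₁ rest

  found : ∀ {c} → c ∈ᴸ L → ∃[ r ] lookup (x ∷ xs) r ∈ c
  found {c} c∈L with x ∈? c
  ... | yes x∈c = zero , x∈c
  ... | no  x∉c with r , hit ← All.lookup (proj₂ rest) (∈ᴸ.∈-filter⁺ (¬? ∘ (x ∈?_)) c∈L x∉c) = suc r , hit

-- Perfect sets

Covers : ∀ t → Vec (Vec (Fin a) n) k → Set
Covers {a} {n} {k} t V = (is : Vec (Fin k) t) → Linked Fin._<_ is → (α : Vec (Fin a) t) →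
                         ∃ λ (r : Fin n) → map (λ i → lookup (lookup V i) r) is ≡ α

-- Pigeonhole: otherwise sending each index to a position of it in `is` would inject `Fin k` into
-- `Fin m`.
missing : m < k → (is : Vec (Fin k) m) → ∃[ i ] i ∉ᵛ is
missing {k = k} m<k is = Fin.¬∀⟶∃¬ k (_∈ᵛ is) (λ i → Membership._∈?_ Fin._≟_ i is) λ all → <⇒≱ m<k
  (Fin.injective⇒≤ {f = Any.index ∘ all} λ {i} {j} eq →
    trans (Any.lookup-index (all i)) (trans (cong (lookup is) eq) (sym (Any.lookup-index (all j)))))

insert : Fin k → Vec (Fin k) m → Vec (Fin k) (suc m)
insert i []       = i ∷ []
insert i (j ∷ js) with Fin.<-cmp i j
... | tri< _ _ _ = i ∷ j ∷ js
... | _          = j ∷ insert i js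

∈-insert : ∀ {l} (i : Fin k) (js : Vec (Fin k) m) → l ∈ᵛ js → l ∈ᵛ insert i js
∈-insert i (j ∷ js) l∈js with Fin.<-cmp i j
... | tri< _ _ _ = there l∈js
∈-insert i (j ∷ js) (here refl)  | tri≈ _ _ _ = here refl
∈-insert i (j ∷ js) (there l∈js) | tri≈ _ _ _ = there (∈-insert i js l∈js)
∈-insert i (j ∷ js) (here refl)  | tri> _ _ _ = here refl
∈-insert i (j ∷ js) (there l∈js) | tri> _ _ _ = there (∈-insert i js l∈js)

All-insert : ∀ (P : Fin k → Set) {i} {js : Vec (Fin k) m} → P i → Allᵛ P js → Allᵛ P (insert i js)
All-insert P pᵢ [] = pᵢ ∷ []
All-insert P {i} {j ∷ _} pᵢ (pⱼ ∷ ps) with Fin.<-cmp i j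
... | tri< _ _ _ = pᵢ ∷ pⱼ ∷ ps
... | tri≈ _ _ _ = pⱼ ∷ All-insert P pᵢ ps
... | tri> _ _ _ = pⱼ ∷ All-insert P pᵢ ps

insert-sorted : ∀ {i} {js : Vec (Fin k) m} → i ∉ᵛ js →
                AllPairsᵛ Fin._<_ js → AllPairsᵛ Fin._<_ (insert i js)
insert-sorted i∉ [] = [] ∷ []
insert-sorted {i = i} {j ∷ _} i∉ (j< ∷ sorted) with Fin.<-cmp i j
... | tri< i<j _ _  = (i<j ∷ Allᵛ.map (Fin.<-trans i<j) j<) ∷ j< ∷ sorted
... | tri≈ _ refl _ = contradiction (here refl) i∉
... | tri> _ _ j<i  = All-insert (j Fin.<_) j<i j< ∷ insert-sorted (i∉ ∘ there) sorted

AllPairs⇒Linked : ∀ {A : Set} {R : Rel A 0ℓ} {xs : Vec A m} → AllPairsᵛ R xs → Linked R xs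
AllPairs⇒Linked []                          = []
AllPairs⇒Linked ([] ∷ _)                    = [-]
AllPairs⇒Linked ((Rxy ∷ _) ∷ Rys@(_ ∷ _))   = Rxy ∷ AllPairs⇒Linked Rys

-- Covering speaks only of increasing `t`-tuples, so shorter tuples are completed by inserting
-- missing indices one at a time; `t ≤ k` ensures that one is available.
extend : m ≤′ t → t ≤ k → {is : Vec (Fin k) m} → AllPairsᵛ Fin._<_ is →
         ∃ λ (js : Vec (Fin k) t) → AllPairsᵛ Fin._<_ js × (∀ i → i ∈ᵛ is → i ∈ᵛ js)
extend ≤′-refl       t≤k sorted = _ , sorted , λ _ → id
extend (≤′-step m≤t) t<k sorted
  with js , js-sorted , is⊆js ← extend m≤t (<⇒≤ t<k) sorted
  with i , i∉js ← missing t<k js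
  = insert i js , insert-sorted i∉js js-sorted , λ l → ∈-insert i js ∘ is⊆js l

map-≡⇒∈ : ∀ {A B : Set} (f g : A → B) {i} {is : Vec A m} → map f is ≡ map g is →
          Any.Any (i ≡_) is → f i ≡ g i
map-≡⇒∈ f g eq (here refl) = Vec.∷-injectiveˡ eq
map-≡⇒∈ f g eq (there i∈)  = map-≡⇒∈ f g (Vec.∷-injectiveʳ eq) i∈

pick : ∀ {A : Set} → Fin k → A → A → Fin k → A
pick i x y j = if does (i Fin.≟ j) then x else y

pick-≡ : ∀ {A : Set} (i : Fin k) {x y : A} → pick i x y i ≡ x
pick-≡ i with i Fin.≟ i
... | yes _  = refl
... | no i≢i = contradiction refl i≢i

pick-≢ : ∀ {A : Set} {i j : Fin k} {x y : A} → i ≢ j → pick i x y j ≡ y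
pick-≢ {i = i} {j} i≢j with i Fin.≟ j
... | yes i≡j = contradiction i≡j i≢j
... | no _    = refl

-- Complete `i < j` to an increasing `t`-tuple and ask for the word with `x` at `i` and `y` at every
-- other index.
covers-pair : (V : Vec (Vec (Fin a) n) k) → 2 ≤ t → t ≤ k → Covers t V →
              ∀ {i j} → i Fin.< j → ∀ x y →
              ∃[ r ] lookup (lookup V i) r ≡ x × lookup (lookup V j) r ≡ y
covers-pair V 2≤t t≤k covers {i} {j} i<j x y
  with is , sorted , ⊆is ← extend (≤⇒≤′ 2≤t) t≤k {i ∷ j ∷ []} ((i<j ∷ []) ∷ [] ∷ [])
  with r , eq ← covers is (AllPairs⇒Linked sorted) (map (pick i x y) is)
  = r , trans (map-≡⇒∈ _ (pick i x y) eq (⊆is i (here refl))) (pick-≡ i)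
      , trans (map-≡⇒∈ _ (pick i x y) eq (⊆is j (there (here refl)))) (pick-≢ (Fin.<⇒≢ i<j))

-- Distinctness follows from covering: some column shows 0 in one of two given rows and 1 in the
-- other.
covers⇒perfect : {V : Vec (Vec (Fin (2 + a)) n) k} → 2 ≤ t → t ≤ k → Covers t V → Perfect (2 + a) t n V
covers⇒perfect {a = a} {k = k} {V = V} 2≤t t≤k covers = record
  { distinct = subst Unique (Vec.tabulate∘lookup V) (AllPairsᵛ.tabulate⁺ distinct)
  ; large    = t≤k
  ; covers   = covers
  }
  where
  separated : ∀ {i j} → i Fin.< j → lookup V i ≢ lookup V j
  separated i<j eq with r , eqᵢ , eqⱼ ← covers-pair V 2≤t t≤k covers i<j zero (suc zero)
    with () ← trans (sym eqᵢ) (trans (cong (λ v → lookup v r) eq) eqⱼ)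
  distinct : ∀ {i j} → i ≢ j → lookup V i ≢ lookup V j
  distinct {i} {j} i≢j with Fin.<-cmp i j
  ... | tri< i<j _ _ = separated i<j
  ... | tri≈ _ i≡j _ = contradiction i≡j i≢j
  ... | tri> _ _ j<i = separated j<i ∘ sym

perfect⇒pairwise-perfect : {V : Vec (Vec (Fin a) n) k} → 2 ≤ t → Perfect a t n V → Perfect a 2 n V
perfect⇒pairwise-perfect {V = V} 2≤t perfect = record
  { distinct = distinct
  ; large    = ≤-trans 2≤t large
  ; covers   = λ { (i ∷ j ∷ []) (i<j ∷ [-]) (x ∷ y ∷ []) →
      let r , eqᵢ , eqⱼ = covers-pair V 2≤t large covers i<j x y
      in r , cong₂ (λ x y → x ∷ y ∷ []) eqᵢ eqⱼ }
  }
  where open Perfect perfect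

-- Upper bound from rare symbols

occurrences : Fin a → Vec (Fin a) n → ℕ
occurrences x = Vec.count (x Fin.≟_)

∑-occurrences : (v : Vec (Fin a) n) → ∑[ x < a ] occurrences x v ≡ n
∑-occurrences {a} []          = sum-replicate-zero a
∑-occurrences {a} {suc n} (y ∷ v) = begin
  ∑[ x < a ] occurrences x (y ∷ v)                                    ≡⟨ sum-cong-≗ split ⟩
  ∑[ x < a ] ((if does (x Fin.≟ y) then 1 else 0) + occurrences x v)  ≡⟨ ∑-distrib-+ {a} _ _ ⟩
  _
    ≡⟨ cong₂ _+_ (∑-indicator y 1) (∑-occurrences v) ⟩
  suc n                                                               ∎
  where
  open ≡-Reasoning
  split : ∀ x → occurrences x (y ∷ v) ≡ (if does (x Fin.≟ y) then 1 else 0) + occurrences x v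
  split x with does (x Fin.≟ y)
  ... | true  = refl
  ... | false = refl

-- x is a rarest symbol of v, and y a rarest among the others.
rare-pair : 2 ≤ a → (v : Vec (Fin a) n) →
            ∃[ x ] ∃[ y ] x ≢ y × a * (occurrences x v + occurrences y v) ≤ 2 * n
rare-pair {suc (suc a)} {n} (s≤s (s≤s z≤n)) v
  with x , x-min ← extremum _≤_ ≤-total ≤-trans (λ x → occurrences x v)
  with j , j-min ← extremum _≤_ ≤-total ≤-trans (λ j → occurrences (punchIn x j) v)
  = x , punchIn x j , Fin.punchInᵢ≢i x j ∘ sym , (begin
    (2 + a) * (#x + #y)
      ≡⟨ solve 3 (λ a x y → (con 2 :+ a) :* (x :+ y) := con 2 :* x :+ con 2 :* y :+ a :* y :+ a :* x) refl a #x #y ⟩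
    2 * #x + 2 * #y + a * #y + a * #x    ≤⟨ +-monoʳ-≤ (2 * #x + 2 * #y + a * #y) (*-monoʳ-≤ a (x-min _)) ⟩
    2 * #x + 2 * #y + a * #y + a * #y
      ≡⟨ solve 3 (λ a x y → con 2 :* x :+ con 2 :* y :+ a :* y :+ a :* y := con 2 :* (x :+ (con 1 :+ a) :* y)) refl a #x #y ⟩
    2 * (#x + (1 + a) * #y)              ≡⟨ cong (λ s → 2 * (#x + s)) (∑-const (1 + a) #y) ⟨
    2 * (#x + ∑[ i < 1 + a ] #y)         ≤⟨ *-monoʳ-≤ 2 (+-monoʳ-≤ #x (∑-mono-≤ j-min)) ⟩
    2 * (#x + ∑[ i < 1 + a ] occurrences (punchIn x i) v)
      ≡⟨ cong (2 *_) (sum-remove (λ x → occurrences x v)) ⟨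
    2 * ∑[ x < 2 + a ] occurrences x v   ≡⟨ cong (2 *_) (∑-occurrences v) ⟩
    2 * n                                ∎)
  where
  open ≤-Reasoning
  open +-*-Solver
  #x = occurrences x v
  #y = occurrences (punchIn x j) v

mark : Fin a → Fin a → Fin a → Maybe (Fin 2)
mark x y s = pick x (just zero) (pick y (just (suc zero)) nothing s) s

-- Only the positions carrying `x` or `y` become prescribed, and each costs a factor 2 in density.
mark-dense : ∀ x y (v : Vec (Fin a) n) →
             Dense (2 ^ (occurrences x v + occurrences y v)) (map (mark x y) v)
mark-dense-step : ∀ x y (v : Vec (Fin a) n) →
                  2 * 2 ^ n ≤ 2 ^ suc (occurrences x v + occurrences y v) * volume (map (mark x y) v)
mark-dense-step {n = n} x y v = begin
  2 * 2 ^ n        ≤⟨ *-monoʳ-≤ 2 (mark-dense x y v) ⟩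
  2 * (2 ^ e * w)  ≡⟨ *-assoc 2 (2 ^ e) w ⟨
  2 ^ suc e * w    ∎
  where
  open ≤-Reasoning
  e = occurrences x v + occurrences y v
  w = volume (map (mark x y) v)
mark-dense x y []      = ≤-refl
mark-dense {n = suc n} x y (s ∷ v) with does (x Fin.≟ s) | does (y Fin.≟ s)
... | false | false = begin
  2 * 2 ^ n          ≤⟨ *-monoʳ-≤ 2 (mark-dense x y v) ⟩
  2 * (2 ^ e * w)    ≡⟨ *-assoc 2 (2 ^ e) w ⟨
  2 * 2 ^ e * w      ≡⟨ cong (_* w) (*-comm 2 (2 ^ e)) ⟩
  2 ^ e * 2 * w      ≡⟨ *-assoc (2 ^ e) 2 w ⟩
  2 ^ e * (2 * w)    ∎
  where
  open ≤-Reasoning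
  e = occurrences x v + occurrences y v
  w = volume (map (mark x y) v)
... | true  | false = mark-dense-step x y v
... | false | true  = ≤-trans (mark-dense-step x y v)
  (≤-reflexive (cong (λ e → 2 ^ e * volume (map (mark x y) v)) (sym (+-suc (occurrences x v) (occurrences y v)))))
-- Here `x` and `y` coincide: the position is counted twice but halves the density once, so the
-- exponent has one to spare.
... | true  | true  = ≤-trans (mark-dense-step x y v)
  (*-monoˡ-≤ (volume (map (mark x y) v)) (^-monoʳ-≤ 2 (s≤s (+-monoʳ-≤ (occurrences x v) (n≤1+n (occurrences y v))))))

-- Each vector is marked by its own rare pair. For `i < j` some column shows `x i` in row `i` and
-- `y j` in row `j`, which become the marks 0 and 1; thus the `k` cubes are disjoint, each of
-- density at least `2^(-s)`.
rare-pairs-bound : ∀ s {V : Vec (Vec (Fin a) n) k} → Perfect a 2 n V →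
                   (∀ i → ∃[ x ] ∃[ y ] x ≢ y × occurrences x (lookup V i) + occurrences y (lookup V i) ≤ s) →
                   k ≤ 2 ^ s
rare-pairs-bound {a} {n} {k} s {V} perfect rare = *-cancelʳ-≤ k (2 ^ s) (2 ^ n) (begin
  k * 2 ^ n                ≡⟨ cong (_* 2 ^ n) (List.length-tabulate cube) ⟨
  length cubes * 2 ^ n     ≤⟨ total-dense (2 ^ s) (All.tabulate⁺ dense) ⟩
  2 ^ s * total cubes      ≤⟨ *-monoʳ-≤ (2 ^ s) (kraft n (AllPairs.tabulate⁺-< conflict)) ⟩
  2 ^ s * 2 ^ n            ∎)
  where
  open ≤-Reasoning
  open Perfect perfect
  instance _ = m^n≢0 2 n

  x y : Fin k → Fin a
  x i = proj₁ (rare i)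
  y i = proj₁ (proj₂ (rare i))

  cube : Fin k → Cube 2 n
  cube i = map (mark (x i) (y i)) (lookup V i)

  cubes : List (Cube 2 n)
  cubes = List.tabulate cube

  dense : ∀ i → Dense (2 ^ s) (cube i)
  dense i = ≤-trans (mark-dense (x i) (y i) (lookup V i))
                    (*-monoˡ-≤ (volume (cube i)) (^-monoʳ-≤ 2 (proj₂ (proj₂ (proj₂ (rare i))))))

  conflict : ∀ {i j} → i Fin.< j → Conflict (cube i) (cube j)
  conflict {i} {j} i<j
    with r , eqᵢ , eqⱼ ← covers-pair V ≤-refl large covers i<j (x i) (y j)
    = r , zero , suc zero
    , trans (Vec.lookup-map r _ (lookup V i)) (trans (cong (mark (x i) (y i)) eqᵢ) (pick-≡ (x i)))
    -- `y j` receives the mark 1 only because it differs from `x j`, which is tested first.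
    , trans (Vec.lookup-map r _ (lookup V j)) (trans (cong (mark (x j) (y j)) eqⱼ)
        (trans (pick-≢ (proj₁ (proj₂ (proj₂ (rare j))))) (pick-≡ (y j))))
    , λ ()

n*m≤o⇒m≤o/n : ∀ m n {o} .{{_ : NonZero n}} → n * m ≤ o → m ≤ o / n
n*m≤o⇒m≤o/n m n {o} nm≤o = begin
  m          ≡⟨ m*n/n≡m m n ⟨
  m * n / n  ≡⟨ /-congˡ (*-comm m n) ⟩
  n * m / n  ≤⟨ /-monoˡ-≤ n nm≤o ⟩
  o / n      ∎
  where open ≤-Reasoning

pairwise-perfect-bound : ∀ a .{{_ : NonZero a}} → 2 ≤ a → PerfectSize a 2 n k → k ≤ 2 ^ (2 * n / a)
pairwise-perfect-bound {n} a 2≤a (V , perfect) = rare-pairs-bound (2 * n / a) perfect λ i →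
  let x , y , x≢y , ≤2n = rare-pair 2≤a (lookup V i) in x , y , x≢y , n*m≤o⇒m≤o/n _ a ≤2n

-- Lower bound: requirements as cubes in the space of columns

prescribe : Vec (Fin k × Fin a) t → Cube a k
prescribe []             = replicate _ nothing
prescribe ((i , s) ∷ ps) = prescribe ps [ i ]≔ just s

volume-replicate : ∀ k → volume (replicate k (nothing {A = Fin a})) ≡ a ^ k
volume-replicate         zero    = refl
volume-replicate {a = a} (suc k) = cong (a *_) (volume-replicate k)

volume-update : ∀ (c : Cube (suc a) k) i s → volume c ≤ suc a * volume (c [ i ]≔ just s)
volume-update         (nothing ∷ c) zero    s = ≤-refl
volume-update {a}     (just _ ∷ c)  zero    s = m≤n*m (volume c) (suc a)
volume-update {a = a} (nothing ∷ c) (suc i) s = *-monoʳ-≤ (suc a) (volume-update c i s)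
volume-update         (just _ ∷ c)  (suc i) s = volume-update c i s

-- Each prescription divides the volume by at most the alphabet size. Overwriting a prescribed row
-- changes no volume, so rows may repeat.
prescribe-dense : (ps : Vec (Fin k × Fin (suc a)) t) → Dense (suc a ^ t) (prescribe ps)
prescribe-dense {k} {a} [] = ≤-reflexive (sym (trans (+-identityʳ _) (volume-replicate k)))
prescribe-dense {k} {a} {suc t} ((i , s) ∷ ps) = begin
  suc a ^ k                                        ≤⟨ prescribe-dense ps ⟩
  suc a ^ t * volume (prescribe ps)
    ≤⟨ *-monoʳ-≤ (suc a ^ t) (volume-update (prescribe ps) i s) ⟩
  suc a ^ t * (suc a * volume (prescribe ps [ i ]≔ just s)) ≡⟨ *-assoc (suc a ^ t) (suc a) _ ⟨
  suc a ^ t * suc a * volume (prescribe ps [ i ]≔ just s)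
    ≡⟨ cong (_* volume (prescribe ps [ i ]≔ just s)) (*-comm (suc a ^ t) (suc a)) ⟩
  suc a ^ suc t * volume (prescribe ps [ i ]≔ just s)       ∎
  where open ≤-Reasoning

lookup-prescribe : {is : Vec (Fin k) t} → AllPairsᵛ _≢_ is → (α : Vec (Fin a) t) → ∀ m →
                   lookup (prescribe (zip is α)) (lookup is m) ≡ just (lookup α m)
lookup-prescribe {is = i ∷ is} _           (s ∷ α) zero    = Vec.lookup∘update i (prescribe (zip is α)) (just s)
lookup-prescribe {is = i ∷ is} (i∉ ∷ uniq) (s ∷ α) (suc m) =
  trans (Vec.lookup∘update′ (Allᵛ.lookup⁺ i∉ m ∘ sym) (prescribe (zip is α)) (just s)) (lookup-prescribe uniq α m)

∈-prescribe : {is : Vec (Fin k) t} → AllPairsᵛ _≢_ is → (α : Vec (Fin a) t) → ∀ {x} →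
              x ∈ prescribe (zip is α) → map (lookup x) is ≡ α
∈-prescribe {is = is} uniq α {x} x∈ = begin
  map (lookup x) is                   ≡⟨ cong (map (lookup x)) (Vec.tabulate∘lookup is) ⟨
  map (lookup x) (tabulate (lookup is)) ≡⟨ Vec.tabulate-∘ (lookup x) (lookup is) ⟨
  tabulate (lookup x ∘ lookup is)     ≡⟨ Vec.tabulate-cong agrees ⟩
  tabulate (lookup α)                 ≡⟨ Vec.tabulate∘lookup α ⟩
  α                                   ∎
  where
  open ≡-Reasoning
  agrees : ∀ m → lookup x (lookup is m) ≡ lookup α m
  agrees m with Maybe.just eq ← subst (Maybe.All (lookup x (lookup is m) ≡_)) (lookup-prescribe uniq α m)
                                  (Pointwise.lookup x∈ (lookup is m)) = eq

Linked⇒Unique : {is : Vec (Fin k) t} → Linked Fin._<_ is → AllPairsᵛ _≢_ is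
Linked⇒Unique []            = []
Linked⇒Unique [-]           = [] ∷ []
Linked⇒Unique (i<j ∷ is<)   = Allᵛ.map Fin.<⇒≢ (Linked.Linked⇒All Fin.<-trans i<j is<) ∷ Linked⇒Unique is<

-- There is one cube for each choice of `t` rows with a symbol for each. Points hitting all the
-- cubes are the columns of the family, and transposing gives its rows.
covering-family : ∀ {E} k n → suc E ≡ suc a ^ t → (k * suc a) ^ t * E ^ n < suc E ^ n →
                  ∃ λ (V : Vec (Vec (Fin (suc a)) n) k) → Covers t V
covering-family {a} {t} {E} k n D≡aᵗ few = V , covers
  where
  -- All `t`-tuples of row-symbol pairs are listed, increasing or not, which makes their number a
  -- plain power.
  decode : Fin ((k * suc a) ^ t) → Vec (Fin k × Fin (suc a)) t
  decode z = tabulate (remQuot (suc a) ∘ finToFun z)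

  decode-surjective : ∀ is α → ∃[ z ] decode z ≡ zip is α
  decode-surjective is α = funToFin code , (begin
    tabulate (remQuot (suc a) ∘ finToFun (funToFin code)) ≡⟨ Vec.tabulate-cong (λ m →
      trans (cong (remQuot (suc a)) (Fin.finToFun-funToFin code m))
            (trans (Fin.remQuot-combine (lookup is m) (lookup α m)) (sym (Vec.lookup-zip m is α)))) ⟩
    tabulate (lookup (zip is α))                          ≡⟨ Vec.tabulate∘lookup (zip is α) ⟩
    zip is α                                              ∎)
    where
    open ≡-Reasoning
    code : Fin t → Fin (k * suc a)
    code m = combine (lookup is m) (lookup α m)

  cubes : List (Cube (suc a) k)
  cubes = List.tabulate (prescribe ∘ decode)

  hit : ∃ λ (xs : Vec (Vec (Fin (suc a)) k) n) → All (λ c → ∃[ r ] lookup xs r ∈ c) cubes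
  hit = hitting-set E n
    (All.tabulate⁺ λ z → subst (λ D → Dense D (prescribe (decode z))) (sym D≡aᵗ) (prescribe-dense (decode z)))
    (subst (λ l → l * E ^ n < suc E ^ n) (sym (List.length-tabulate (prescribe ∘ decode))) few)

  columns : Vec (Vec (Fin (suc a)) k) n
  columns = proj₁ hit

  V : Vec (Vec (Fin (suc a)) n) k
  V = tabulate λ i → tabulate λ r → lookup (lookup columns r) i

  lookup-V : ∀ i r → lookup (lookup V i) r ≡ lookup (lookup columns r) i
  lookup-V i r = trans (cong (λ v → lookup v r) (Vec.lookup∘tabulate _ i)) (Vec.lookup∘tabulate _ r)

  covers : Covers t V
  covers is is< α
    with z , decode-z ← decode-surjective is α
    with r , r∈ ← All.tabulate⁻ (proj₂ hit) z
    = r , trans (Vec.map-cong (λ i → lookup-V i r) is)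
                (∈-prescribe (Linked⇒Unique is<) α (subst (λ ps → lookup columns r ∈ prescribe ps) decode-z r∈))

-- Arithmetic estimates

0<nCk : ∀ {n k} → k ≤ n → 0 < n C k
0<nCk {n}     {zero}  _         = s≤s z≤n
0<nCk {suc n} {suc k} (s≤s k≤n) = begin
  1                   ≤⟨ 0<nCk k≤n ⟩
  n C k               ≤⟨ m≤m+n (n C k) (n C suc k) ⟩
  n C k + n C suc k   ≡⟨ nCk+nC[k+1]≡[n+1]C[k+1] n k ⟩
  suc n C suc k       ∎
  where open ≤-Reasoning

nCk≤[n+1]Ck : ∀ n k → n C k ≤ suc n C k
nCk≤[n+1]Ck n zero    = ≤-refl
nCk≤[n+1]Ck n (suc k) = ≤-trans (m≤n+m (n C suc k) (n C k)) (≤-reflexive (nCk+nC[k+1]≡[n+1]C[k+1] n k))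

C-monoˡ-≤ : ∀ k {m n} → m ≤ n → m C k ≤ n C k
C-monoˡ-≤ k {m} m≤n with d , refl ← m≤n⇒∃[o]m+o≡n m≤n = go d
  where
  go : ∀ d → m C k ≤ (m + d) C k
  go zero    rewrite +-identityʳ m = ≤-refl
  go (suc d) rewrite +-suc m d     = ≤-trans (go d) (nCk≤[n+1]Ck (m + d) k)

-- After expanding both sides by Pascal's rule the terms are compared crosswise, `i` with `suc j`
-- and `suc i` with `j`: both pairs have index sum `i + j + 1`, which the hypothesis still allows.
C-unimodal : ∀ n {i j} → i ≤ j → i + j ≤ n → n C i ≤ n C j
C-unimodal n       {zero}  {j}     _         j≤n           = 0<nCk j≤n
C-unimodal (suc n) {suc i} {suc j} (s≤s i≤j) (s≤s i+1+j≤n) with m≤n⇒m<n∨m≡n i≤j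
... | inj₂ refl = ≤-refl
... | inj₁ i<j  = begin
  suc n C suc i       ≡⟨ nCk+nC[k+1]≡[n+1]C[k+1] n i ⟨
  n C i + n C suc i   ≤⟨ +-mono-≤ (C-unimodal n (m≤n⇒m≤1+n i≤j) i+1+j≤n)
                                  (C-unimodal n i<j (≤-trans (≤-reflexive (sym (+-suc i j))) i+1+j≤n)) ⟩
  n C suc j + n C j   ≡⟨ +-comm (n C suc j) (n C j) ⟩
  n C j + n C suc j   ≡⟨ nCk+nC[k+1]≡[n+1]C[k+1] n j ⟩
  suc n C suc j       ∎
  where open ≤-Reasoning

-- Three uses of Pascal's rule split the right side into four terms, each at least `n C k`; the term
-- `n C suc k` is where `k` must lie below the middle.
C-growth : ∀ n k → k + suc k ≤ n → 4 * (n C k) ≤ (3 + n) C suc k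
C-growth n k 2k+1≤n = begin
  4 * (n C k)
    ≡⟨ solve 1 (λ x → con 4 :* x := x :+ (x :+ (x :+ x))) refl (n C k) ⟩
  n C k + (n C k + (n C k + n C k))
    ≤⟨ +-mono-≤ (C-monoˡ-≤ k (m≤n+m n 2)) (+-mono-≤ (C-monoˡ-≤ k (m≤n+m n 1)) (+-monoʳ-≤ (n C k)
                                                                          (C-unimodal n (n≤1+n k) 2k+1≤n))) ⟩
  (2 + n) C k + ((1 + n) C k + (n C k + n C suc k))
    ≡⟨ cong (λ x → (2 + n) C k + ((1 + n) C k + x)) (nCk+nC[k+1]≡[n+1]C[k+1] n k) ⟩
  (2 + n) C k + ((1 + n) C k + (1 + n) C suc k)
    ≡⟨ cong ((2 + n) C k +_) (nCk+nC[k+1]≡[n+1]C[k+1] (1 + n) k) ⟩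
  (2 + n) C k + (2 + n) C suc k                                      ≡⟨ nCk+nC[k+1]≡[n+1]C[k+1] (2 + n) k ⟩
  (3 + n) C suc k                                                    ∎
  where open ≤-Reasoning; open +-*-Solver

2*4^k≤[3k∸1]C[k∸1] : ∀ j → 2 * 4 ^ (j + 7) ≤ (j * 3 + 20) C (j + 6)
-- For `k = 7` this reads 32768 ≤ 38760; at `k = 6` it fails, 8192 against 6188. This is the source
-- of `7 * a` in the threshold.
2*4^k≤[3k∸1]C[k∸1] zero    = from-yes (2 * 4 ^ 7 ≤? 20 C 6)
2*4^k≤[3k∸1]C[k∸1] (suc j) = begin
  2 * (4 * 4 ^ (j + 7))
    ≡⟨ solve 1 (λ x → con 2 :* (con 4 :* x) := con 4 :* (con 2 :* x)) refl (4 ^ (j + 7)) ⟩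
  4 * (2 * 4 ^ (j + 7))           ≤⟨ *-monoʳ-≤ 4 (2*4^k≤[3k∸1]C[k∸1] j) ⟩
  4 * ((j * 3 + 20) C (j + 6))    ≤⟨ C-growth (j * 3 + 20) (j + 6) small ⟩
  (suc j * 3 + 20) C (suc j + 6)  ∎
  where
  open ≤-Reasoning; open +-*-Solver
  small : j + 6 + suc (j + 6) ≤ j * 3 + 20
  small = ≤-trans (m≤m+n _ (j + 7)) (≤-reflexive
    (solve 1 (λ j → j :+ con 6 :+ (con 1 :+ (j :+ con 6)) :+ (j :+ con 7) := j :* con 3 :+ con 20) refl j))

2n/a≤1+2[n/a] : ∀ n a .{{_ : NonZero a}} → 2 * n / a ≤ 1 + 2 * (n / a)
2n/a≤1+2[n/a] n a = s≤s⁻¹ (m<n*o⇒m/o<n (begin-strict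
  2 * n                            ≡⟨ cong (2 *_) (m≡m%n+[m/n]*n n a) ⟩
  2 * (n % a + n / a * a)          <⟨ *-monoʳ-< 2 (+-monoˡ-< (n / a * a) (m%n<n n a)) ⟩
  2 * (a + n / a * a)
    ≡⟨ solve 2 (λ a q → con 2 :* (a :+ q :* a) := (con 2 :+ con 2 :* q) :* a) refl a (n / a) ⟩
  (2 + 2 * (n / a)) * a            ∎))
  where open ≤-Reasoning; open +-*-Solver

-- With `q = n / a`, the power is at most `2 * 4 ^ q`, while `a ≥ 3` gives `3q ≤ n`, so the upper
-- index is at least `3q - 1`.
binomial-bound : ∀ a n .{{_ : NonZero a}} → 3 ≤ a → 7 * a ≤ n → 2 ^ (2 * n / a) ≤ (n ∸ 1) C (n / a ∸ 1)
binomial-bound a n 3≤a 7a≤n = begin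
  2 ^ (2 * n / a)               ≤⟨ ^-monoʳ-≤ 2 (2n/a≤1+2[n/a] n a) ⟩
  2 * 2 ^ (2 * (n / a))         ≡⟨ cong (2 *_) (^-*-assoc 2 2 (n / a)) ⟨
  2 * 4 ^ (n / a)               ≡⟨ cong (λ q → 2 * 4 ^ q) n/a≡j+7 ⟩
  2 * 4 ^ (j + 7)               ≤⟨ 2*4^k≤[3k∸1]C[k∸1] j ⟩
  (j * 3 + 20) C (j + 6)        ≤⟨ C-monoˡ-≤ (j + 6) 3j+20≤n∸1 ⟩
  (n ∸ 1) C (j + 6)             ≡⟨ cong ((n ∸ 1) C_) (cong (_∸ 1) (trans n/a≡j+7 (+-suc j 6))) ⟨
  (n ∸ 1) C (n / a ∸ 1)         ∎
  where
  open ≤-Reasoning; open +-*-Solver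
  7≤n/a : 7 ≤ n / a
  7≤n/a = ≤-trans (≤-reflexive (sym (m*n/n≡m 7 a))) (/-monoˡ-≤ a 7a≤n)
  j = n / a ∸ 7
  n/a≡j+7 : n / a ≡ j + 7
  n/a≡j+7 = sym (m∸n+n≡m 7≤n/a)
  3j+20≤n∸1 : j * 3 + 20 ≤ n ∸ 1
  3j+20≤n∸1 = ∸-monoˡ-≤ 1 (begin
    1 + (j * 3 + 20)  ≡⟨ solve 1 (λ j → con 1 :+ (j :* con 3 :+ con 20) := (j :+ con 7) :* con 3) refl j ⟩
    (j + 7) * 3       ≡⟨ cong (_* 3) n/a≡j+7 ⟨
    n / a * 3         ≤⟨ *-monoʳ-≤ (n / a) 3≤a ⟩
    n / a * a         ≤⟨ m/n*n≤m n a ⟩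
    n                 ∎)

-- Comparison of exponentials

^-distribʳ-* : ∀ n x y → (x * y) ^ n ≡ x ^ n * y ^ n
^-distribʳ-* zero    x y = refl
^-distribʳ-* (suc n) x y = trans (cong (x * y *_) (^-distribʳ-* n x y)) (*-interchange x y (x ^ n) (y ^ n))

-- Cubing reduces the claim to 4·5³ ≤ 8³.
2^s*5^n≤8^n : ∀ s n → s * 3 ≤ 2 * n → 2 ^ s * 5 ^ n ≤ 8 ^ n
2^s*5^n≤8^n s n 3s≤2n = ≮⇒≥ λ 8ⁿ< → <⇒≱ (^-monoˡ-< 3 8ⁿ<) (begin
  (2 ^ s * 5 ^ n) ^ 3          ≡⟨ ^-distribʳ-* 3 (2 ^ s) (5 ^ n) ⟩
  (2 ^ s) ^ 3 * (5 ^ n) ^ 3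
    ≡⟨ cong₂ _*_ (^-*-assoc 2 s 3) (trans (^-*-assoc 5 n 3) (trans (cong (5 ^_) (*-comm n 3)) (sym (^-*-assoc 5 3 n)))) ⟩
  2 ^ (s * 3) * 125 ^ n        ≤⟨ *-monoˡ-≤ (125 ^ n) (^-monoʳ-≤ 2 3s≤2n) ⟩
  2 ^ (2 * n) * 125 ^ n        ≡⟨ cong (_* 125 ^ n) (^-*-assoc 2 2 n) ⟨
  4 ^ n * 125 ^ n              ≡⟨ ^-distribʳ-* n 4 125 ⟨
  500 ^ n                      ≤⟨ ^-monoˡ-≤ n (m≤m+n 500 12) ⟩
  512 ^ n
    ≡⟨ trans (^-*-assoc 8 3 n) (trans (cong (8 ^_) (*-comm 3 n)) (sym (^-*-assoc 8 n 3))) ⟩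
  (8 ^ n) ^ 3                  ∎)
  where open ≤-Reasoning

-- (1 + 1/E)ᵐ ≥ 1 + m/E, with denominators cleared.
bernoulli-+ : ∀ E m → E ^ m * (E + m) ≤ E * suc E ^ m
bernoulli-+ E zero    = ≤-reflexive (solve 1 (λ e → con 1 :* (e :+ con 0) := e :* con 1) refl E)
  where open +-*-Solver
bernoulli-+ E (suc m) = begin
  E * E ^ m * (E + suc m)        ≤⟨ m≤m+n _ (E ^ m * m) ⟩
  E * E ^ m * (E + suc m) + E ^ m * m
    ≡⟨ solve 3 (λ e p m → e :* p :* (e :+ (con 1 :+ m)) :+ p :* m := p :* (e :+ m) :* (con 1 :+ e)) refl E (E ^ m) m ⟩
  E ^ m * (E + m) * suc E        ≤⟨ *-monoˡ-≤ (suc E) (bernoulli-+ E m) ⟩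
  E * suc E ^ m * suc E
    ≡⟨ solve 2 (λ e p → e :* p :* (con 1 :+ e) := e :* ((con 1 :+ e) :* p)) refl E (suc E ^ m) ⟩
  E * (suc E * suc E ^ m)        ∎
  where open ≤-Reasoning; open +-*-Solver

2*E^E≤[1+E]^E : ∀ E .{{_ : NonZero E}} → 2 * E ^ E ≤ suc E ^ E
2*E^E≤[1+E]^E E = *-cancelˡ-≤ E (begin
  E * (2 * E ^ E)   ≡⟨ solve 2 (λ e p → e :* (con 2 :* p) := p :* (e :+ e)) refl E (E ^ E) ⟩
  E ^ E * (E + E)   ≤⟨ bernoulli-+ E E ⟩
  E * suc E ^ E     ∎)
  where open ≤-Reasoning; open +-*-Solver

-- (1 − 1/(m+w))ᵐ ≥ 1 − m/(m+w), with denominators cleared and z = m + w − 1.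
bernoulli-− : ∀ m w z → suc z ≡ m + w → suc z ^ m * w ≤ z ^ m * suc z
bernoulli-− zero    w z eq = ≤-reflexive (cong (1 *_) (sym eq))
bernoulli-− (suc m) w z eq = begin
  suc z * suc z ^ m * w
    ≡⟨ solve 3 (λ z p w → (con 1 :+ z) :* p :* w := p :* (z :* w :+ w)) refl z (suc z ^ m) w ⟩
  suc z ^ m * (z * w + w)    ≤⟨ *-monoʳ-≤ (suc z ^ m) (+-monoʳ-≤ (z * w) w≤z) ⟩
  suc z ^ m * (z * w + z)
    ≡⟨ solve 3 (λ z p w → p :* (z :* w :+ z) := z :* (p :* (con 1 :+ w))) refl z (suc z ^ m) w ⟩
  z * (suc z ^ m * suc w)    ≤⟨ *-monoʳ-≤ z (bernoulli-− m (suc w) z (trans eq (sym (+-suc m w)))) ⟩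
  z * (z ^ m * suc z)        ≡⟨ *-assoc z (z ^ m) (suc z) ⟨
  z * z ^ m * suc z          ∎
  where
  open ≤-Reasoning; open +-*-Solver
  w≤z : w ≤ z
  w≤z = ≤-trans (m≤n+m w m) (≤-reflexive (sym (suc-injective eq)))

-- This is `(1 - 1/(2B))^B ≥ 1/2`: the ratio `2B/(2B-1)`, later `λ₁`, has `B`-th power at most 2.
[2B]^B≤2*[2B∸1]^B : ∀ B .{{_ : NonZero B}} → (2 * B) ^ B ≤ 2 * (2 * B ∸ 1) ^ B
[2B]^B≤2*[2B∸1]^B B@(suc b) = *-cancelʳ-≤ _ _ B (begin
  (2 * B) ^ B * B                  ≤⟨ bernoulli-− B B (2 * B ∸ 1) (cong (B +_) (+-identityʳ B)) ⟩
  (2 * B ∸ 1) ^ B * (2 * B)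
    ≡⟨ solve 2 (λ p b → p :* (con 2 :* b) := con 2 :* p :* b) refl ((2 * B ∸ 1) ^ B) B ⟩
  2 * (2 * B ∸ 1) ^ B * B          ∎)
  where open ≤-Reasoning; open +-*-Solver

n<2^n : ∀ n → n < 2 ^ n
n<2^n zero    = s≤s z≤n
n<2^n (suc n) = +-mono-≤ (m^n>0 2 n) (≤-trans (n<2^n n) (m≤m+n (2 ^ n) 0))

-- The exponent `n` contains `q * t` blocks of length `E`, each worth a factor 2 by `2*E^E≤[1+E]^E`;
-- the remaining `r` factors only help.
2^[qt]*E^n≤[1+E]^n : ∀ E t q r .{{_ : NonZero E}} → let n = r + q * (E * t) in
                     2 ^ (q * t) * E ^ n ≤ suc E ^ n
2^[qt]*E^n≤[1+E]^n E t q r = begin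
  2 ^ (q * t) * E ^ (r + q * (E * t))       ≡⟨ cong (2 ^ (q * t) *_) (power-split E) ⟩
  2 ^ (q * t) * (E ^ r * (E ^ E) ^ (q * t))
    ≡⟨ solve 3 (λ x y z → x :* (y :* z) := y :* (x :* z)) refl (2 ^ (q * t)) (E ^ r) ((E ^ E) ^ (q * t)) ⟩
  E ^ r * (2 ^ (q * t) * (E ^ E) ^ (q * t)) ≡⟨ cong (E ^ r *_) (^-distribʳ-* (q * t) 2 (E ^ E)) ⟨
  E ^ r * (2 * E ^ E) ^ (q * t)
    ≤⟨ *-mono-≤ (^-monoˡ-≤ r (n≤1+n E)) (^-monoˡ-≤ (q * t) (2*E^E≤[1+E]^E E)) ⟩
  suc E ^ r * (suc E ^ E) ^ (q * t)         ≡⟨ power-split (suc E) ⟨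
  suc E ^ (r + q * (E * t))                 ∎
  where
  open ≤-Reasoning; open +-*-Solver
  power-split : ∀ x → x ^ (r + q * (E * t)) ≡ x ^ r * (x ^ E) ^ (q * t)
  power-split x = begin-equality
    x ^ (r + q * (E * t))       ≡⟨ ^-distribˡ-+-* x r (q * (E * t)) ⟩
    x ^ r * x ^ (q * (E * t))
      ≡⟨ cong (λ e → x ^ r * x ^ e) (solve 3 (λ q e t → q :* (e :* t) := e :* (q :* t)) refl q E t) ⟩
    x ^ r * x ^ (E * (q * t))   ≡⟨ cong (x ^ r *_) (^-*-assoc x E (q * t)) ⟨
    x ^ r * (x ^ E) ^ (q * t)   ∎

-- Since `a < 2 ^ a`, having `2^(q-a)` rows leaves fewer than `2^(qt)` requirements.
few-requirements : ∀ E a t n .{{_ : NonZero E}} .{{_ : NonZero t}} .{{_ : NonZero (E * t)}} →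
                   a ≤ n / (E * t) →
                   (2 ^ (n / (E * t) ∸ a) * a) ^ t * E ^ n < suc E ^ n
few-requirements E a t n a≤q = begin-strict
  (2 ^ (q ∸ a) * a) ^ t * E ^ n        <⟨ *-monoˡ-< (E ^ n) {{m^n≢0 E n}} (^-monoˡ-< t ka<2^q) ⟩
  (2 ^ q) ^ t * E ^ n                  ≡⟨ cong (_* E ^ n) (^-*-assoc 2 q t) ⟩
  2 ^ (q * t) * E ^ n                  ≡⟨ cong (λ n → 2 ^ (q * t) * E ^ n) n≡ ⟩
  2 ^ (q * t) * E ^ (r + q * (E * t))  ≤⟨ 2^[qt]*E^n≤[1+E]^n E t q r ⟩
  suc E ^ (r + q * (E * t))            ≡⟨ cong (suc E ^_) n≡ ⟨
  suc E ^ n                            ∎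
  where
  open ≤-Reasoning
  q = n / (E * t)
  r = n % (E * t)
  n≡ = m≡m%n+[m/n]*n n (E * t)
  ka<2^q : 2 ^ (q ∸ a) * a < 2 ^ q
  ka<2^q = begin-strict
    2 ^ (q ∸ a) * a      <⟨ *-monoʳ-< (2 ^ (q ∸ a)) {{m^n≢0 2 (q ∸ a)}} (n<2^n a) ⟩
    2 ^ (q ∸ a) * 2 ^ a  ≡⟨ ^-distribˡ-+-* 2 (q ∸ a) a ⟨
    2 ^ (q ∸ a + a)      ≡⟨ cong (2 ^_) (m∸n+n≡m a≤q) ⟩
    2 ^ q                ∎

-- With `λ = 2B/(2B-1)` and `n = r + Bq`, `λ^B ≤ 2` gives `λ^n ≤ λ^r * 2^q`. The factor
-- `(2 * B) ^ B` absorbs the remainder `r < B`, and `2 ^ a` the shift of `q` by `a`.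
exponential-bound : ∀ B a n .{{_ : NonZero B}} →
                    (2 * B) ^ n ≤ 2 ^ a * (2 * B) ^ B * ((2 * B ∸ 1) ^ n * 2 ^ (n / B ∸ a))
exponential-bound B@(suc b) a n = begin
  u ^ n                                     ≡⟨ split u ⟩
  u ^ r * (u ^ B) ^ q
    ≤⟨ *-mono-≤ (^-monoʳ-≤ u (<⇒≤ (m%n<n n B))) (^-monoˡ-≤ q ([2B]^B≤2*[2B∸1]^B B)) ⟩
  u ^ B * (2 * v ^ B) ^ q                   ≡⟨ cong (u ^ B *_) (^-distribʳ-* q 2 (v ^ B)) ⟩
  u ^ B * (2 ^ q * (v ^ B) ^ q)
    ≤⟨ *-monoʳ-≤ (u ^ B) (*-mono-≤ (^-monoʳ-≤ 2 (m≤n+m∸n q a)) (m≤n*m ((v ^ B) ^ q) (v ^ r))) ⟩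
  u ^ B * (2 ^ (a + (q ∸ a)) * (v ^ r * (v ^ B) ^ q))
    ≡⟨ cong₂ (λ x y → u ^ B * (x * y)) (^-distribˡ-+-* 2 a (q ∸ a)) (sym (split v)) ⟩
  u ^ B * (2 ^ a * 2 ^ (q ∸ a) * v ^ n)
    ≡⟨ solve 4 (λ x y z w → x :* (y :* z :* w) := y :* x :* (w :* z)) refl (u ^ B) (2 ^ a) (2 ^ (q ∸ a)) (v ^ n) ⟩
  2 ^ a * u ^ B * (v ^ n * 2 ^ (q ∸ a))     ∎
  where
  open ≤-Reasoning; open +-*-Solver
  u = 2 * B
  v = 2 * B ∸ 1
  q = n / B
  r = n % B
  instance
    v≢0 : NonZero v
    v≢0 = >-nonZero (m<n⇒0<n∸m {1} {2 * B} (*-monoʳ-≤ 2 (s≤s {0} {b} z≤n)))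
    _ = m^n≢0 v r
  split : ∀ x → x ^ n ≡ x ^ r * (x ^ B) ^ q
  split x = begin-equality
    x ^ n
      ≡⟨ cong (x ^_) (trans (m≡m%n+[m/n]*n n B) (cong (λ e → n % B + e) (*-comm (n / B) B))) ⟩
    x ^ (r + B * q)      ≡⟨ ^-distribˡ-+-* x r (B * q) ⟩
    x ^ r * x ^ (B * q)  ≡⟨ cong (x ^ r *_) (^-*-assoc x B q) ⟨
    x ^ r * (x ^ B) ^ q  ∎

-- Transfer to rational numbers

toℚᵘ-/ : ∀ x d .{{_ : NonZero d}} → toℚᵘ (x ℚ./ d) ℚᵘ.≃ x ℚᵘ./ d
toℚᵘ-/ x (suc d) = ℚ.toℚᵘ-fromℚᵘ (mkℚᵘ x d)

fromℕ-mono-≤ : ∀ {m n} → m ≤ n → fromℕ m ℚ.≤ fromℕ n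
fromℕ-mono-≤ {m} {n} m≤n = ℚ.toℚᵘ-cancel-≤
  (ℚᵘ.≤-respˡ-≃ (ℚᵘ.≃-sym (toℚᵘ-/ (ℤ.+ m) 1)) (ℚᵘ.≤-respʳ-≃ (ℚᵘ.≃-sym (toℚᵘ-/ (ℤ.+ n) 1))
    (*≤* (ℤ.*-monoʳ-≤-nonNeg (ℤ.+ 1) (ℤ.+≤+ m≤n)))))

fromℕ-* : ∀ m n → fromℕ (m * n) ≡ fromℕ m ℚ.* fromℕ n
fromℕ-* m n = ℚ.toℚᵘ-injective (begin-equality
  toℚᵘ (fromℕ (m * n))                   ≃⟨ toℚᵘ-/ (ℤ.+ (m * n)) 1 ⟩
  (ℤ.+ (m * n)) ℚᵘ./ 1                     ≃⟨ *≡* (cong (ℤ._* ℤ.+ 1) (ℤ.pos-* m n)) ⟩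
  ((ℤ.+ m) ℚᵘ./ 1) ℚᵘ.* ((ℤ.+ n) ℚᵘ./ 1)     ≃⟨ ℚᵘ.*-cong (toℚᵘ-/ (ℤ.+ m) 1) (toℚᵘ-/ (ℤ.+ n) 1) ⟨
  toℚᵘ (fromℕ m) ℚᵘ.* toℚᵘ (fromℕ n)     ≃⟨ ℚ.toℚᵘ-homo-* (fromℕ m) (fromℕ n) ⟨
  toℚᵘ (fromℕ m ℚ.* fromℕ n)             ∎)
  where open ℚᵘ.≤-Reasoning

/-*-cancel : ∀ m d .{{_ : NonZero d}} → ((ℤ.+ m) ℚ./ d) ℚ.* fromℕ d ≡ fromℕ m
/-*-cancel m d@(suc _) = ℚ.toℚᵘ-injective (begin-equality
  toℚᵘ (((ℤ.+ m) ℚ./ d) ℚ.* fromℕ d)           ≃⟨ ℚ.toℚᵘ-homo-* ((ℤ.+ m) ℚ./ d) (fromℕ d) ⟩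
  toℚᵘ ((ℤ.+ m) ℚ./ d) ℚᵘ.* toℚᵘ (fromℕ d)     ≃⟨ ℚᵘ.*-cong (toℚᵘ-/ (ℤ.+ m) d) (toℚᵘ-/ (ℤ.+ d) 1) ⟩
  ((ℤ.+ m) ℚᵘ./ d) ℚᵘ.* ((ℤ.+ d) ℚᵘ./ 1)
    ≃⟨ *≡* (trans (ℤ.*-identityʳ _) (cong (λ e → ℤ.+ m ℤ.* ℤ.+ e) (sym (*-identityʳ d)))) ⟩
  (ℤ.+ m) ℚᵘ./ 1                               ≃⟨ toℚᵘ-/ (ℤ.+ m) 1 ⟨
  toℚᵘ (fromℕ m)                             ∎)
  where open ℚᵘ.≤-Reasoning

/-^-cancel : ∀ u v n .{{_ : NonZero v}} → ((ℤ.+ u) ℚ./ v) ^ℚ n ℚ.* fromℕ (v ^ n) ≡ fromℕ (u ^ n)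
/-^-cancel u v zero    = refl
/-^-cancel u v (suc n) = begin
  l ℚ.* l ^ℚ n ℚ.* fromℕ (v * v ^ n)                ≡⟨ cong (l ℚ.* l ^ℚ n ℚ.*_) (fromℕ-* v (v ^ n)) ⟩
  l ℚ.* l ^ℚ n ℚ.* (fromℕ v ℚ.* fromℕ (v ^ n))      ≡⟨ ℚ-interchange l (l ^ℚ n) (fromℕ v) (fromℕ (v ^ n)) ⟩
  l ℚ.* fromℕ v ℚ.* (l ^ℚ n ℚ.* fromℕ (v ^ n))      ≡⟨ cong₂ ℚ._*_ (/-*-cancel u v) (/-^-cancel u v n) ⟩
  fromℕ u ℚ.* fromℕ (u ^ n)                         ≡⟨ fromℕ-* u (u ^ n) ⟨
  fromℕ (u * u ^ n)                                 ∎
  where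
  open ≡-Reasoning
  l = (ℤ.+ u) ℚ./ v

fromℕ-positive : ∀ n .{{_ : NonZero n}} → ℚ.Positive (fromℕ n)
fromℕ-positive n@(suc _) = ℚ.normalize-pos n 1

scaled-power≤ : ∀ u v M P n .{{_ : NonZero v}} .{{_ : NonZero M}} → u ^ n ≤ M * (v ^ n * P) →
                ((ℤ.+ 1) ℚ./ M) ℚ.* ((ℤ.+ u) ℚ./ v) ^ℚ n ℚ.≤ fromℕ P
scaled-power≤ u v M P n u^n≤ = ℚ.*-cancelʳ-≤-pos (fromℕ (M * v ^ n)) {{fromℕ-positive (M * v ^ n)}} (begin
  c ℚ.* l ^ℚ n ℚ.* fromℕ (M * v ^ n)              ≡⟨ cong (c ℚ.* l ^ℚ n ℚ.*_) (fromℕ-* M (v ^ n)) ⟩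
  c ℚ.* l ^ℚ n ℚ.* (fromℕ M ℚ.* fromℕ (v ^ n))    ≡⟨ ℚ-interchange c (l ^ℚ n) (fromℕ M) (fromℕ (v ^ n)) ⟩
  c ℚ.* fromℕ M ℚ.* (l ^ℚ n ℚ.* fromℕ (v ^ n))    ≡⟨ cong₂ ℚ._*_ (/-*-cancel 1 M) (/-^-cancel u v n) ⟩
  1ℚ ℚ.* fromℕ (u ^ n)                            ≡⟨ ℚ.*-identityˡ (fromℕ (u ^ n)) ⟩
  fromℕ (u ^ n)                                   ≤⟨ fromℕ-mono-≤ (≤-trans u^n≤ (≤-reflexive rearrange)) ⟩
  fromℕ (P * (M * v ^ n))                         ≡⟨ fromℕ-* P (M * v ^ n) ⟩
  fromℕ P ℚ.* fromℕ (M * v ^ n)                   ∎)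
  where
  open ℚ.≤-Reasoning
  instance
    _ = m^n≢0 v n
    _ = m*n≢0 M (v ^ n)
  c = (ℤ.+ 1) ℚ./ M
  l = (ℤ.+ u) ℚ./ v
  rearrange : M * (v ^ n * P) ≡ P * (M * v ^ n)
  rearrange = trans (sym (*-assoc M (v ^ n) P)) (*-comm (M * v ^ n) P)

≤power : ∀ u v P n .{{_ : NonZero v}} → P * v ^ n ≤ u ^ n → fromℕ P ℚ.≤ ((ℤ.+ u) ℚ./ v) ^ℚ n
≤power u v P n Pv^n≤ = ℚ.*-cancelʳ-≤-pos (fromℕ (v ^ n)) {{fromℕ-positive (v ^ n) {{m^n≢0 v n}}}} (begin
  fromℕ P ℚ.* fromℕ (v ^ n)               ≡⟨ fromℕ-* P (v ^ n) ⟨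
  fromℕ (P * v ^ n)                       ≤⟨ fromℕ-mono-≤ Pv^n≤ ⟩
  fromℕ (u ^ n)                           ≡⟨ /-^-cancel u v n ⟨
  ((ℤ.+ u) ℚ./ v) ^ℚ n ℚ.* fromℕ (v ^ n)    ∎)
  where open ℚ.≤-Reasoning

0<1/n : ∀ n .{{_ : NonZero n}} → 0ℚ ℚ.< (ℤ.+ 1) ℚ./ n
0<1/n n = ℚ.positive⁻¹ ((ℤ.+ 1) ℚ./ n) {{ℚ.normalize-pos 1 n}}

d<n⇒1<n/d : ∀ {n d} .{{_ : NonZero d}} → d < n → 1ℚ ℚ.< (ℤ.+ n) ℚ./ d
d<n⇒1<n/d {n} {d@(suc _)} d<n = ℚ.toℚᵘ-cancel-< (ℚᵘ.<-respʳ-≃ (ℚᵘ.≃-sym (toℚᵘ-/ (ℤ.+ n) d))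
  (*<* (subst₂ ℤ._<_ (sym (ℤ.*-identityˡ (ℤ.+ d))) (sym (ℤ.*-identityʳ (ℤ.+ n))) (ℤ.+<+ d<n))))

-- With E = aᵗ − 1, (1 + 1/E)^E ≥ 2; so Et further columns pay for doubling the
-- number of vectors, which may therefore be about 2^(n/(Et)).
private
  exponent : ℕ → ℕ → ℕ
  exponent a t = (a ^ t ∸ 1) * t

1<a^t : ∀ {a t} → 2 ≤ a → 2 ≤ t → 1 < a ^ t
1<a^t {a} {t} 2≤a 2≤t = ≤-trans (s≤s (s≤s z≤n)) (≤-trans (^-monoʳ-≤ 2 2≤t) (^-monoˡ-≤ t 2≤a))

exponent≢0 : ∀ {a t} → 2 ≤ a → 2 ≤ t → NonZero (exponent a t)
exponent≢0 {a} {t} 2≤a 2≤t = m*n≢0 (a ^ t ∸ 1) t {{>-nonZero (m<n⇒0<n∸m (1<a^t 2≤a 2≤t))}} {{>-nonZero (<⇒≤ 2≤t)}}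

-- The bound on `n` gives a quotient `q ≥ a + t`: the part `a` keeps the subtraction exact, and the
-- part `t` makes the size at least `2 ^ t`, which exceeds `t`.
perfect-set : ∀ a t n .{{_ : NonZero (exponent a t)}} → 2 ≤ a → 2 ≤ t → (a + t) * exponent a t ≤ n →
              PerfectSize a t n (2 ^ (n / exponent a t ∸ a))
perfect-set a@(suc _) t n 2≤a@(s≤s (s≤s _)) 2≤t [a+t]B≤n = V , covers⇒perfect {V = V} 2≤t t≤k covers
  where
  B = exponent a t
  instance
    _ = >-nonZero (m<n⇒0<n∸m (1<a^t {a} 2≤a 2≤t))
    _ = >-nonZero (<⇒≤ 2≤t)
  a+t≤q : a + t ≤ n / B
  a+t≤q = n*m≤o⇒m≤o/n (a + t) B (≤-trans (≤-reflexive (*-comm B (a + t))) [a+t]B≤n)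
  t≤k : t ≤ 2 ^ (n / B ∸ a)
  t≤k = ≤-trans (<⇒≤ (n<2^n t)) (^-monoʳ-≤ 2 (m+n≤o⇒m≤o∸n t (≤-trans (≤-reflexive (+-comm t a)) a+t≤q)))
  family = covering-family (2 ^ (n / B ∸ a)) n (m+[n∸m]≡n {1} {a ^ t} (<⇒≤ (1<a^t 2≤a 2≤t)))
             (few-requirements (a ^ t ∸ 1) a t n (≤-trans (m≤m+n a t) a+t≤q))
  V = proj₁ family
  covers = proj₂ family

-- Choice of the constants and assembly of the bounds

theorem3 : (a : ℕ) → .{{_ : NonZero a}} → 3 ≤ a →
    ∃[ c₂ ] ∃[ λ₂ ] (0ℚ ℚ.< c₂ × λ₂ ℚ.< fromℕ 2 ×
    ((t : ℕ) → 2 ≤ t →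
    ∃[ c₁ ] ∃[ λ₁ ] ∃[ n₀ ] (0ℚ ℚ.< c₁ × 1ℚ ℚ.< λ₁ × a ^ t ≤ n₀ ×
    ((n : ℕ) → n₀ ≤ n →
    (c₁ ℚ.* λ₁ ^ℚ n) ℚ.≤ fromℕ (p a t n)
    × fromℕ (p a 2 n) ℚ.≤ (c₂ ℚ.* λ₂ ^ℚ n)
    × p a t n ≤ p a 2 n
    × p a 2 n ≤ (n ∸ 1) C (n / a ∸ 1)))))
theorem3 a 3≤a =
  -- The growth rate `2^(2/a)` is at most the cube root of 4, about 1.587, for every `a ≥ 3`, so 8/5
  -- serves for all `a` and `t`.
  1ℚ , (ℤ.+ 8) ℚ./ 5 , from-yes (0ℚ ℚ.<? 1ℚ) , from-yes ((ℤ.+ 8) ℚ./ 5 ℚ.<? fromℕ 2) , bounds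
  where
  2≤a : 2 ≤ a
  2≤a = <⇒≤ 3≤a

  module _ (t : ℕ) (2≤t : 2 ≤ t) where
    B M n₀ : ℕ
    B  = exponent a t
    M  = 2 ^ a * (2 * B) ^ B
    -- The summands serve `perfect-set`, `binomial-bound` and the demand `a ^ t ≤ n₀`, in this
    -- order.
    n₀ = (a + t) * B + 7 * a + a ^ t

    instance
      B≢0 : NonZero B
      B≢0 = exponent≢0 2≤a 2≤t
      2B≢0 : NonZero (2 * B)
      2B≢0 = m*n≢0 2 B
      M≢0 : NonZero M
      M≢0 = m*n≢0 (2 ^ a) ((2 * B) ^ B) {{m^n≢0 2 a}} {{m^n≢0 (2 * B) B}}
      v≢0 : NonZero (2 * B ∸ 1)
      v≢0 = >-nonZero (m<n⇒0<n∸m (m≤m*n 2 B))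

    module _ (n : ℕ) (n₀≤n : n₀ ≤ n) where
      set : PerfectSize a t n (2 ^ (n / B ∸ a))
      set = perfect-set a t n 2≤a 2≤t (m+n≤o⇒m≤o ((a + t) * B) (m+n≤o⇒m≤o ((a + t) * B + 7 * a) n₀≤n))

      pair-set : PerfectSize a 2 n (p a t n)
      -- The value of `p` is attained only if some perfect set exists, since it defaults to 0; `set`
      -- provides one.
      pair-set with V , perfect ← p-attained {a} {t} {n} set = V , perfect⇒pairwise-perfect 2≤t perfect

      p₂≤ : p a 2 n ≤ 2 ^ (2 * n / a)
      p₂≤ = pairwise-perfect-bound a 2≤a (p-attained {a} {2} {n} pair-set)

      s*3≤2n : 2 * n / a * 3 ≤ 2 * n
      s*3≤2n = ≤-trans (*-monoʳ-≤ (2 * n / a) 3≤a) (m/n*n≤m (2 * n) a)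

      lower : ((ℤ.+ 1) ℚ./ M) ℚ.* ((ℤ.+ (2 * B)) ℚ./ (2 * B ∸ 1)) ^ℚ n ℚ.≤ fromℕ (p a t n)
      lower = ℚ.≤-trans (scaled-power≤ (2 * B) (2 * B ∸ 1) M (2 ^ (n / B ∸ a)) n (exponential-bound B a n))
                        (fromℕ-mono-≤ (p-maximal {a} {t} {n} set))

      upper : fromℕ (p a 2 n) ℚ.≤ 1ℚ ℚ.* ((ℤ.+ 8) ℚ./ 5) ^ℚ n
      upper = ℚ.≤-trans (≤power 8 5 (p a 2 n) n
                          (≤-trans (*-monoˡ-≤ (5 ^ n) p₂≤) (2^s*5^n≤8^n (2 * n / a) n s*3≤2n)))
                        (ℚ.≤-reflexive (sym (ℚ.*-identityˡ (((ℤ.+ 8) ℚ./ 5) ^ℚ n))))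

      binomial : p a 2 n ≤ (n ∸ 1) C (n / a ∸ 1)
      binomial = ≤-trans p₂≤ (binomial-bound a n 3≤a
        (m+n≤o⇒n≤o ((a + t) * B) (m+n≤o⇒m≤o ((a + t) * B + 7 * a) n₀≤n)))

    1<λ₁ : 1ℚ ℚ.< (ℤ.+ (2 * B)) ℚ./ (2 * B ∸ 1)
    1<λ₁ = d<n⇒1<n/d (≤-reflexive (m+[n∸m]≡n (>-nonZero⁻¹ (2 * B))))

  bounds : (t : ℕ) → 2 ≤ t →
    ∃[ c₁ ] ∃[ λ₁ ] ∃[ n₀ ] (0ℚ ℚ.< c₁ × 1ℚ ℚ.< λ₁ × a ^ t ≤ n₀ ×
    ((n : ℕ) → n₀ ≤ n →
    (c₁ ℚ.* λ₁ ^ℚ n) ℚ.≤ fromℕ (p a t n)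
    × fromℕ (p a 2 n) ℚ.≤ (1ℚ ℚ.* ((ℤ.+ 8) ℚ./ 5) ^ℚ n)
    × p a t n ≤ p a 2 n
    × p a 2 n ≤ (n ∸ 1) C (n / a ∸ 1)))
  bounds t 2≤t =
    ((ℤ.+ 1) ℚ./ M t 2≤t) {{M≢0 t 2≤t}}
    , ((ℤ.+ (2 * B t 2≤t)) ℚ./ (2 * B t 2≤t ∸ 1)) {{v≢0 t 2≤t}}
    , n₀ t 2≤t
    , 0<1/n (M t 2≤t) {{M≢0 t 2≤t}} , 1<λ₁ t 2≤t , m≤n+m (a ^ t) ((a + t) * B t 2≤t + 7 * a)
    , λ n n₀≤n → lower t 2≤t n n₀≤n , upper t 2≤t n n₀≤n
    , p-maximal {a} {2} {n} (pair-set t 2≤t n n₀≤n) , binomial t 2≤t n n₀≤n
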